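{- Let $c\ge1$ and let $T$ be a labelled $c$-grid possessing symmetry (vertical, rotational and slide symmetry). If the four edge-ratio relationships are satisfied at every $(r,d)$ in the upper left half of the $c$-grid, then the four edge-ratio relationships are satisfied in the entire $c$-grid.
   Context: **Labelled grids.** For $c\ge 1$, a $c$-grid is the triangular graph made of $c$ rows of upright triangles: row $r$ ($1\le r\le c$, counted from the top) contains the upright triangles $T_{r,d}$, $1\le d\le r$, counted from the left. The edges of the graph are exactly the left, right and base edges of the upright triangles, and each edge belongs to exactly one upright triangle. A labelled $c$-grid $T$ is an arbitrary assignment of positive real labels (resistances) $T_{L,r,d},T_{R,r,d},T_{B,r,d}$ to the left, right and base edges of each $T_{r,d}$, $1\le d\le r\le c$. **Symmetries.** For all $1\le d\le r\le c$: *vertical symmetry*: $T_{L,r,d}=T_{R,r,r+1-d}$, $T_{B,r,d}=T_{B,r,r+1-d}$; *rotational symmetry*: $T_{L,r,d}=T_{R,c+d-r,c+1-r}$, $T_{R,r,d}=T_{B,c+d-r,c+1-r}$, $T_{B,r,d}=T_{L,c+d-r,c+1-r}$; *slide symmetry*: $T_{L,r,d}=T_{L,c+d-r,d}$, $T_{R,r,d}=T_{B,c+d-r,d}$. **Edge-ratio functions.** $$r_{R,L}(r,d)=\frac{2(r-d)+1}{2d-1},\qquad r_{B,L}(c,r,d)=\frac{2(c-r)+1}{2d-1},$$ $$x(c,r)=\frac{r-1}{2r-1}\cdot\frac{2(c-r)+3}{(c-r)+1},\qquad y(r,d)=\frac{d-1}{2d-3}\cdot\frac{2(r-d)+3}{(r-d)+1}.$$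 **The four edge-ratio relationships** at $(r,d)$, $1\le d\le r\le c$, are: vertical (only when $d=1$, $r\ge2$): $T_{L,r,1}=x(c,r)\,T_{L,r-1,1}$; horizontal (only when $d\ge2$): $T_{L,r,d}=y(r,d)\,T_{L,r,d-1}$; right-left: $T_{R,r,d}=r_{R,L}(r,d)\,T_{L,r,d}$; base-left: $T_{B,r,d}=r_{B,L}(c,r,d)\,T_{L,r,d}$. They are satisfied in the entire $c$-grid if they hold at all $(r,d)$ with $1\le d\le r\le c$. **Upper left half.** The upper left half of the $c$-grid consists of the triangles $T_{r,d}$ with $1\le d\le\lfloor\frac{c+2}{3}\rfloor$ and $2d-1\le r\le\lfloor\frac{c+d}{2}\rfloor$. -}

module Defs where

open import Algebra.Apartness.Bundles using (HeytingCommutativeRing; HeytingField)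
open import Algebra.Bundles using (CommutativeRing)
import Algebra.Definitions.RawMonoid as RawMonoidDefinitions
open import Algebra.Definitions using (Invertible)
open import Data.Nat
  using (ℕ; zero; suc; _+_; _*_; _∸_; _≤_; s≤s; _≤?_; NonZero; >-nonZero)
open import Data.Nat.DivMod using () renaming (_/_ to _div_)
open import Data.Nat.Properties
  using ( +-comm; ≤-refl; ≤-trans; ≤-reflexive; <⇒≤; m<n⇒0<n∸m; m∸n≤m
        ; m+n∸m≡n; m+n∸n≡m; ∸-monoˡ-≤; ∸-monoʳ-≤; +-monoˡ-≤; +-monoʳ-≤; *-monoʳ-≤ )
open import Data.Product using (∃-syntax; _×_; proj₁)
open import Data.Sum using (_⊎_; inj₂)
open import Function.Bundles using (_⇔_; Equivalence)
open import Level using (Level; _⊔_) renaming (suc to lsuc)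
open import Relation.Binary.Core using (Rel)
open import Relation.Binary.PropositionalEquality using (_≡_; sym)
open import Relation.Binary.Structures using (IsStrictPartialOrder)
open import Relation.Nullary.Decidable using (recompute)

private variable
  a ℓ₁ ℓ₂ ℓ₃ : Level
  c : ℕ

-- The real numbers, given axiomatically as a Cauchy complete Archimedean
-- ordered field.  Apartness is the Heyting-field rendering of "x ≠ y", so that
-- both the classical reals and the constructive Cauchy reals are models.  The
-- stdlib axioms of a Heyting field already exclude the trivial ring.
record RealNumbers (a ℓ₁ ℓ₂ ℓ₃ : Level) : Set (lsuc (a ⊔ ℓ₁ ⊔ ℓ₂ ⊔ ℓ₃)) where
  infix 4 _<ʳ_

  field
    heytingField : HeytingField a ℓ₁ ℓ₂

  open HeytingField heytingField public
    renaming (_+_ to _+ʳ_; _*_ to _*ʳ_; -_ to -ʳ_; _-_ to _-ʳ_; refl to ≈-refl; sym to ≈-sym; trans to ≈-trans)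

  open CommutativeRing (HeytingCommutativeRing.commutativeRing heytingCommutativeRing) public
    using (+-rawMonoid)

  open RawMonoidDefinitions +-rawMonoid public
    using () renaming (_×_ to _·_)

  field
    _<ʳ_                 : Rel Carrier ℓ₃
    isStrictPartialOrder : IsStrictPartialOrder _≈_ _<ʳ_
    #⇔<⊎>                : ∀ {x y} → x # y ⇔ (x <ʳ y ⊎ y <ʳ x)
    0<1                  : 0# <ʳ 1#
    +-monoʳ-<ʳ           : ∀ x {y z} → y <ʳ z → x +ʳ y <ʳ x +ʳ z
    *-pos                : ∀ {x y} → 0# <ʳ x → 0# <ʳ y → 0# <ʳ x *ʳ y
    archimedean          : ∀ x → ∃[ n ] x <ʳ n · 1#

  -- |x - y| < 1/(k+1)
  Close : ℕ → Rel Carrier ℓ₃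
  Close k x y = (suc k · (x -ʳ y) <ʳ 1#) × (suc k · (y -ʳ x) <ʳ 1#)

  field
    complete : (s : ℕ → Carrier) →
               (∀ k → ∃[ N ] (∀ m n → N ≤ m → N ≤ n → Close k (s m) (s n))) →
               ∃[ l ] (∀ k → ∃[ N ] (∀ n → N ≤ n → Close k (s n) l))

  private module < = IsStrictPartialOrder isStrictPartialOrder

  0<suc·1 : ∀ n → 0# <ʳ suc n · 1#
  0<suc·1 zero    = <.<-respʳ-≈ (≈-sym (+-identityʳ 1#)) 0<1
  0<suc·1 (suc n) =
    <.trans 0<1 (<.<-respˡ-≈ (+-identityʳ 1#) (+-monoʳ-<ʳ 1# (0<suc·1 n)))

  suc·1-invertible : ∀ n → Invertible _≈_ 1# _*ʳ_ (suc n · 1# -ʳ 0#)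
  suc·1-invertible n = #⇒invertible (Equivalence.from #⇔<⊎> (inj₂ (0<suc·1 n)))

  infixl 7 _/ʳ_

  -- The inverse below is that of q - 0, the form in which
  -- #⇒invertible supplies it.
  _/ʳ_ : (p q : ℕ) .{{_ : NonZero q}} → Carrier
  p /ʳ suc q = (p · 1#) *ʳ proj₁ (suc·1-invertible q)

data Side : Set where
  L R B : Side

record Triangle (c : ℕ) : Set where
  constructor tri
  field
    row col  : ℕ
    .1≤col   : 1 ≤ col
    .col≤row : col ≤ row
    .row≤c   : row ≤ c

open Triangle public using (row; col)

1≤col : (t : Triangle c) → 1 ≤ col t
1≤col (tri r d p _ _) = recompute (1 ≤? d) p

col≤row : (t : Triangle c) → col t ≤ row t
col≤row (tri r d _ q _) = recompute (d ≤? r) q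

row≤c : (t : Triangle c) → row t ≤ c
row≤c {c} (tri r d _ _ s) = recompute (r ≤? c) s

-- Every edge belongs to exactly one upright triangle, so an edge is a side of a
-- triangle.
record LabelledGrid (ℝ : RealNumbers a ℓ₁ ℓ₂ ℓ₃) (c : ℕ) : Set (a ⊔ ℓ₃) where
  open RealNumbers ℝ
  field
    label    : Side → Triangle c → Carrier
    positive : ∀ s t → 0# <ʳ label s t

private
  1≤n+1∸m : ∀ {m n} → m ≤ n → 1 ≤ n + 1 ∸ m
  1≤n+1∸m {m} {n} m≤n rewrite +-comm n 1 = m<n⇒0<n∸m (s≤s m≤n)

  n+1∸m≤n : ∀ {m n} → 1 ≤ m → n + 1 ∸ m ≤ n
  n+1∸m≤n {suc m} {n} _ rewrite +-comm n 1 = m∸n≤m n m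

  n+m∸k≤n : ∀ n {m k} → m ≤ k → n + m ∸ k ≤ n
  n+m∸k≤n n {m} {k} m≤k =
    ≤-trans (∸-monoʳ-≤ (n + m) m≤k) (≤-reflexive (m+n∸n≡m n m))

flip : Triangle c → Triangle c
flip (tri r d 1≤d d≤r r≤c) =
  tri r (r + 1 ∸ d) (1≤n+1∸m d≤r) (n+1∸m≤n 1≤d) r≤c

rotate : Triangle c → Triangle c
rotate {c} (tri r d 1≤d d≤r r≤c) =
  tri (c + d ∸ r) (c + 1 ∸ r) (1≤n+1∸m r≤c)
      (∸-monoˡ-≤ r (+-monoʳ-≤ c 1≤d)) (n+m∸k≤n c d≤r)

slide : Triangle c → Triangle c
slide {c} (tri r d 1≤d d≤r r≤c) =
  tri (c + d ∸ r) d 1≤d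
      (≤-trans (≤-reflexive (sym (m+n∸m≡n r d))) (∸-monoˡ-≤ r (+-monoˡ-≤ d r≤c)))
      (n+m∸k≤n c d≤r)

above : (t : Triangle c) → .(col t ≡ 1) → .(2 ≤ row t) → Triangle c
above (tri r d _ _ r≤c) _ 2≤r =
  tri (r ∸ 1) 1 ≤-refl (∸-monoˡ-≤ 1 2≤r) (≤-trans (m∸n≤m r 1) r≤c)

leftOf : (t : Triangle c) → .(2 ≤ col t) → Triangle c
leftOf (tri r d _ d≤r r≤c) 2≤d =
  tri r (d ∸ 1) (∸-monoˡ-≤ 1 2≤d) (≤-trans (m∸n≤m d 1) d≤r) r≤c

module _ {ℝ : RealNumbers a ℓ₁ ℓ₂ ℓ₃} (T : LabelledGrid ℝ c) where
  open RealNumbers ℝ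
  open LabelledGrid T

  record VerticalSymmetry : Set ℓ₁ where
    field
      left-right : ∀ t → label L t ≈ label R (flip t)
      base-base  : ∀ t → label B t ≈ label B (flip t)

  record RotationalSymmetry : Set ℓ₁ where
    field
      left-right : ∀ t → label L t ≈ label R (rotate t)
      right-base : ∀ t → label R t ≈ label B (rotate t)
      base-left  : ∀ t → label B t ≈ label L (rotate t)

  record SlideSymmetry : Set ℓ₁ where
    field
      left-left  : ∀ t → label L t ≈ label L (slide t)
      right-base : ∀ t → label R t ≈ label B (slide t)

  record Symmetric : Set ℓ₁ where
    field
      vertical   : VerticalSymmetry
      rotational : RotationalSymmetry
      slides     : SlideSymmetry

2d∸1-nonZero : ∀ {d} → .(1 ≤ d) → NonZero (2 * d ∸ 1)
2d∸1-nonZero {d} 1≤d =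
  >-nonZero (m<n⇒0<n∸m (*-monoʳ-≤ 2 (recompute (1 ≤? d) 1≤d)))

2d∸3-nonZero : ∀ {d} → .(2 ≤ d) → NonZero (2 * d ∸ 3)
2d∸3-nonZero {d} 2≤d =
  >-nonZero (m<n⇒0<n∸m (*-monoʳ-≤ 2 (recompute (2 ≤? d) 2≤d)))

-- In the ranges where the ratios are used no truncation occurs in _∸_.
module EdgeRatios (ℝ : RealNumbers a ℓ₁ ℓ₂ ℓ₃) where
  open RealNumbers ℝ

  rRL : (r d : ℕ) → .(1 ≤ d) → Carrier
  rRL r d 1≤d = (2 * (r ∸ d) + 1) /ʳ (2 * d ∸ 1)
    where instance _ = 2d∸1-nonZero 1≤d

  rBL : (c r d : ℕ) → .(1 ≤ d) → Carrier
  rBL c r d 1≤d = (2 * (c ∸ r) + 1) /ʳ (2 * d ∸ 1)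
    where instance _ = 2d∸1-nonZero 1≤d

  ratioX : (c r : ℕ) → .(2 ≤ r) → Carrier
  ratioX c r 2≤r =
    ((r ∸ 1) /ʳ (2 * r ∸ 1)) *ʳ ((2 * (c ∸ r) + 3) /ʳ suc (c ∸ r))
    where instance _ = 2d∸1-nonZero (<⇒≤ 2≤r)

  ratioY : (r d : ℕ) → .(2 ≤ d) → Carrier
  ratioY r d 2≤d =
    ((d ∸ 1) /ʳ (2 * d ∸ 3)) *ʳ ((2 * (r ∸ d) + 3) /ʳ suc (r ∸ d))
    where instance _ = 2d∸3-nonZero 2≤d

module _ {ℝ : RealNumbers a ℓ₁ ℓ₂ ℓ₃} {c : ℕ} (T : LabelledGrid ℝ c) where
  open RealNumbers ℝ
  open LabelledGrid T
  open EdgeRatios ℝ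

  record EdgeRatioRelationships (t : Triangle c) : Set ℓ₁ where
    field
      vertical   : (d≡1 : col t ≡ 1) (2≤r : 2 ≤ row t) →
                   label L t ≈ ratioX c (row t) 2≤r *ʳ label L (above t d≡1 2≤r)
      horizontal : (2≤d : 2 ≤ col t) →
                   label L t ≈ ratioY (row t) (col t) 2≤d *ʳ label L (leftOf t 2≤d)
      right-left : label R t ≈ rRL (row t) (col t) (1≤col t) *ʳ label L t
      base-left  : label B t ≈ rBL c (row t) (col t) (1≤col t) *ʳ label L t

record UpperLeftHalf (t : Triangle c) : Set where
  field
    col-bound : col t ≤ (c + 2) div 3
    row-lower : 2 * col t ∸ 1 ≤ row t
    row-upper : row t ≤ (c + col t) div 2

{-# OPTIONS --safe #-}
module Submission where

-- Write α = d - 1, β = r - d, γ = c - r for the distances of T_{r,d} to the three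
-- sides of the grid, so that α + β + γ = c - 1.  The vertical and slide symmetries
-- exchange α with β and β with γ, carrying L to R and R to B respectively, and the
-- upper left half is the fundamental domain α ≤ β ≤ γ of the group they generate.
-- With h(n) = n! / (2n + 1)!!, the four relationships say exactly that
--   L = (2α + 1) w,  R = (2β + 1) w,  B = (2γ + 1) w,   w = k h(α) h(β) h(γ)
-- for a constant k, a form invariant under both exchanges.

open import Defs
open import Algebra.Bundles using (CommutativeRing)
open import Algebra.Apartness.Bundles using (HeytingCommutativeRing)
import Algebra.Solver.CommutativeMonoid as CommutativeMonoidSolver
import Algebra.Apartness.Properties.HeytingCommutativeRing as HeytingProperties
open import Data.Nat
  using (ℕ; zero; suc; _+_; _*_; _∸_; _≤_; z≤n; s≤s; s≤s⁻¹; NonZero)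
open import Data.Nat.DivMod using (/-monoˡ-≤; m*n/n≡m) renaming (_/_ to _div_)
open import Data.Nat.Properties
  using ( +-comm; +-assoc; +-suc; ≤-trans; ≤-reflexive; ≤-total; n≤1+n; m≤m+n
        ; m+n∸m≡n; m+[n∸m]≡n; +-mono-≤; +-monoˡ-≤; +-monoʳ-≤; module ≤-Reasoning )
open import Data.Nat.Solver using (module +-*-Solver)
open import Data.Product using (_,_; proj₁; proj₂; ∃-syntax)
open import Data.Sum using (inj₁; inj₂)
open import Function.Bundles using (_⇔_; mk⇔; Equivalence)
open import Level using (Level)
open import Relation.Binary.PropositionalEquality
  using (_≡_; refl; sym; trans; cong; subst; module ≡-Reasoning)
import Relation.Binary.Reasoning.Setoid as SetoidReasoning

private variable
  a ℓ₁ ℓ₂ ℓ₃ : Level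
  c : ℕ

-- Triangles by their distances to the sides, and the symmetries acting on them.

m*n≤o⇒m≤o/n : ∀ {m n o} .{{_ : NonZero n}} → m * n ≤ o → m ≤ o div n
m*n≤o⇒m≤o/n {m} {n} {o} mn≤o =
  subst (_≤ o div n) (m*n/n≡m m n) (/-monoˡ-≤ n mn≤o)

tri-≡ : {t t′ : Triangle c} → row t ≡ row t′ → col t ≡ col t′ → t ≡ t′
tri-≡ {t = tri _ _ _ _ _} {t′ = tri _ _ _ _ _} refl refl = refl

-- The equation is irrelevant, so triangles built from different proofs of it agree definitionally.
at : (α β γ : ℕ) → .(suc (α + β + γ) ≡ c) → Triangle c
at α β γ e =
  tri (suc (α + β)) (suc α) (s≤s z≤n) (s≤s (m≤m+n α β))
      (≤-trans (s≤s (m≤m+n (α + β) γ)) (≤-reflexive e))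

at-elim : ∀ {p} (P : Triangle c → Set p) →
          (∀ α β γ (e : suc (α + β + γ) ≡ c) → P (at α β γ e)) → ∀ t → P t
at-elim {c} P P-at t@(tri (suc r) (suc d) _ _ _) =
  subst P (tri-≡ (cong suc α+β≡r) refl) (P-at d (r ∸ d) (c ∸ suc r) e)
  where
  α+β≡r : d + (r ∸ d) ≡ r
  α+β≡r = m+[n∸m]≡n (s≤s⁻¹ (col≤row t))
  e : suc (d + (r ∸ d) + (c ∸ suc r)) ≡ c
  e = trans (cong (λ m → suc (m + (c ∸ suc r))) α+β≡r) (m+[n∸m]≡n (row≤c t))
at-elim P P-at t@(tri zero    (suc d) _ _ _) with () ← col≤row t
at-elim P P-at t@(tri _       zero    _ _ _) with () ← 1≤col t

module _ {α β γ : ℕ} where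

  swapˡ : suc (α + β + γ) ≡ c → suc (β + α + γ) ≡ c
  swapˡ = trans (cong (λ m → suc (m + γ)) (+-comm β α))

  swapʳ : suc (α + β + γ) ≡ c → suc (α + γ + β) ≡ c
  swapʳ = trans (cong suc (xy∙z≈xz∙y α γ β))
    where
    open +-*-Solver
    xy∙z≈xz∙y : ∀ x y z → x + y + z ≡ x + z + y
    xy∙z≈xz∙y = solve 3 (λ x y z → x :+ y :+ z := x :+ z :+ y) refl

  flip-at : (e : suc (α + β + γ) ≡ c) → flip (at α β γ e) ≡ at β α γ (swapˡ e)
  flip-at e = tri-≡ (cong suc (+-comm α β)) (begin
    α + β + 1 ∸ α    ≡⟨ cong (_∸ α) (+-assoc α β 1) ⟩
    α + (β + 1) ∸ α  ≡⟨ m+n∸m≡n α (β + 1) ⟩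
    β + 1            ≡⟨ +-comm β 1 ⟩
    suc β            ∎)
    where open ≡-Reasoning

  slide-at : (e : suc (α + β + γ) ≡ c) → slide (at α β γ e) ≡ at α γ β (swapʳ e)
  slide-at refl = tri-≡ (begin
    α + β + γ + suc α ∸ (α + β)    ≡⟨ cong (_∸ (α + β)) (+-assoc (α + β) γ (suc α)) ⟩
    α + β + (γ + suc α) ∸ (α + β)  ≡⟨ m+n∸m≡n (α + β) (γ + suc α) ⟩
    γ + suc α                      ≡⟨ +-comm γ (suc α) ⟩
    suc (α + γ)                    ∎) refl
    where open ≡-Reasoning

  -- Cleared of division and truncated subtraction, the three bounds read 3α ≤ α + β + γ, α ≤ β and
  -- β ≤ γ. The first comes from adding α ≤ β and α ≤ γ to α ≤ α.
  upperLeftHalf : (e : suc (α + β + γ) ≡ c) → α ≤ β → β ≤ γ → UpperLeftHalf (at α β γ e)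
  upperLeftHalf refl α≤β β≤γ = record
    { col-bound = m*n≤o⇒m≤o/n (begin
        suc α * 3              ≡⟨ solve 1 (λ a → (con 1 :+ a) :* con 3
                                                 := con 1 :+ (a :+ a :+ a) :+ con 2) refl α ⟩
        suc (α + α + α) + 2    ≤⟨ +-monoˡ-≤ 2 (s≤s (+-mono-≤ (+-monoʳ-≤ α α≤β) (≤-trans α≤β β≤γ))) ⟩
        suc (α + β + γ) + 2    ∎)
    ; row-lower = begin
        α + suc (α + 0)        ≡⟨ solve 1 (λ a → a :+ (con 1 :+ (a :+ con 0))
                                                 := con 1 :+ (a :+ a)) refl α ⟩
        suc (α + α)            ≤⟨ s≤s (+-monoʳ-≤ α α≤β) ⟩
        suc (α + β)            ∎
    ; row-upper = m*n≤o⇒m≤o/n (begin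
        suc (α + β) * 2              ≡⟨ solve 2 (λ a b → (con 1 :+ (a :+ b)) :* con 2
                                                 := con 1 :+ (a :+ b :+ b) :+ (con 1 :+ a)) refl α β ⟩
        suc (α + β + β) + suc α      ≤⟨ +-monoˡ-≤ (suc α) (s≤s (+-monoʳ-≤ (α + β) β≤γ)) ⟩
        suc (α + β + γ) + suc α      ∎)
    }
    where
    open ≤-Reasoning
    open +-*-Solver

leftOf-at : ∀ {α β γ} (e : suc (suc α + β + γ) ≡ c) .(2≤d : 2 ≤ suc (suc α)) →
            leftOf (at (suc α) β γ e) 2≤d
            ≡ at α (suc β) γ (trans (cong (λ m → suc (m + γ)) (+-suc α β)) e)
leftOf-at {α = α} {β} e 2≤d = tri-≡ (cong suc (sym (+-suc α β))) refl

-- Fractions of natural numbers inside the real numbers.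

module Arithmetic (ℝ : RealNumbers a ℓ₁ ℓ₂ ℓ₃) where
  open RealNumbers ℝ hiding (+-comm; +-assoc)
  private
    module HCR = HeytingCommutativeRing heytingCommutativeRing
    *-monoid = CommutativeRing.*-commutativeMonoid HCR.commutativeRing
  open HeytingProperties heytingCommutativeRing using (x-0≈x)
  open CommutativeMonoidSolver *-monoid using (solve; _⊕_; _⊜_)
  open SetoidReasoning setoid

  ⟦_⟧ : ℕ → Carrier
  ⟦ n ⟧ = n · 1#

  odd : ℕ → Carrier
  odd n = ⟦ suc (2 * n) ⟧

  recip : ℕ → Carrier
  recip n = proj₁ (suc·1-invertible n)

  recip-inverseˡ : ∀ n → recip n *ʳ ⟦ suc n ⟧ ≈ 1#
  recip-inverseˡ n =
    ≈-trans (*-congˡ (≈-sym (x-0≈x _))) (proj₁ (proj₂ (suc·1-invertible n)))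

  ⟦⟧-cancelˡ : ∀ q .{{_ : NonZero q}} {x y} → ⟦ q ⟧ *ʳ x ≈ ⟦ q ⟧ *ʳ y → x ≈ y
  ⟦⟧-cancelˡ (suc n) {x} {y} qx≈qy = begin
    x                            ≈⟨ expand x ⟩
    recip n *ʳ (⟦ suc n ⟧ *ʳ x)  ≈⟨ *-congˡ qx≈qy ⟩
    recip n *ʳ (⟦ suc n ⟧ *ʳ y)  ≈⟨ expand y ⟨
    y                            ∎
    where
    expand : ∀ z → z ≈ recip n *ʳ (⟦ suc n ⟧ *ʳ z)
    expand z = begin
      z                              ≈⟨ *-identityˡ z ⟨
      1# *ʳ z                        ≈⟨ *-congʳ (recip-inverseˡ n) ⟨
      recip n *ʳ ⟦ suc n ⟧ *ʳ z      ≈⟨ *-assoc _ _ _ ⟩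
      recip n *ʳ (⟦ suc n ⟧ *ʳ z)    ∎

  /-cancelˡ : ∀ p q .{{_ : NonZero q}} → ⟦ q ⟧ *ʳ (p /ʳ q) ≈ ⟦ p ⟧
  /-cancelˡ p (suc n) = begin
    ⟦ suc n ⟧ *ʳ (⟦ p ⟧ *ʳ recip n)  ≈⟨ solve 3 (λ x y z → x ⊕ (y ⊕ z) ⊜ y ⊕ (z ⊕ x)) ≈-refl _ _ _ ⟩
    ⟦ p ⟧ *ʳ (recip n *ʳ ⟦ suc n ⟧)  ≈⟨ *-congˡ (recip-inverseˡ n) ⟩
    ⟦ p ⟧ *ʳ 1#                      ≈⟨ *-identityʳ _ ⟩
    ⟦ p ⟧                            ∎

  -- The denominators of the ratios are only propositionally equal to odd numbers
  -- (and carry their own NonZero proofs), hence the equations on p and q.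
  cross : ∀ {p q p′ q′} .{{_ : NonZero q}} → p ≡ p′ → q ≡ q′ → ∀ {x y} →
          x ≈ p /ʳ q *ʳ y ⇔ ⟦ q′ ⟧ *ʳ x ≈ ⟦ p′ ⟧ *ʳ y
  cross {p} {q} refl refl {x} {y} = mk⇔
    (λ x≈ → ≈-trans (*-congˡ x≈) clear)
    (λ qx≈py → ⟦⟧-cancelˡ q (≈-trans qx≈py (≈-sym clear)))
    where
    clear : ⟦ q ⟧ *ʳ (p /ʳ q *ʳ y) ≈ ⟦ p ⟧ *ʳ y
    clear = ≈-trans (≈-sym (*-assoc _ _ _)) (*-congʳ (/-cancelˡ p q))

  -- Counterpart of `cross` for the products of two fractions in `ratioX` and `ratioY`; the two
  -- denominators are cancelled one after the other.
  cross₂ : ∀ {p q p′ q′ u v u′ v′} .{{_ : NonZero q}} .{{_ : NonZero v}} →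
           p ≡ p′ → q ≡ q′ → u ≡ u′ → v ≡ v′ → ∀ {x y} →
           x ≈ p /ʳ q *ʳ (u /ʳ v) *ʳ y ⇔
           ⟦ v′ ⟧ *ʳ (⟦ q′ ⟧ *ʳ x) ≈ ⟦ u′ ⟧ *ʳ (⟦ p′ ⟧ *ʳ y)
  cross₂ {p} {q} {u = u} {v} refl refl refl refl {x} {y} = mk⇔
    (λ x≈ → ≈-trans (*-congˡ (*-congˡ x≈)) clear)
    (λ eq → ⟦⟧-cancelˡ q (⟦⟧-cancelˡ v (≈-trans eq (≈-sym clear))))
    where
    clear : ⟦ v ⟧ *ʳ (⟦ q ⟧ *ʳ (p /ʳ q *ʳ (u /ʳ v) *ʳ y)) ≈ ⟦ u ⟧ *ʳ (⟦ p ⟧ *ʳ y)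
    clear = begin
      ⟦ v ⟧ *ʳ (⟦ q ⟧ *ʳ (p /ʳ q *ʳ (u /ʳ v) *ʳ y))
        ≈⟨ solve 5 (λ v q s t y → v ⊕ (q ⊕ ((s ⊕ t) ⊕ y)) ⊜ (v ⊕ t) ⊕ ((q ⊕ s) ⊕ y)) ≈-refl _ _ _ _ _ ⟩
      (⟦ v ⟧ *ʳ (u /ʳ v)) *ʳ ((⟦ q ⟧ *ʳ (p /ʳ q)) *ʳ y)
        ≈⟨ *-cong (/-cancelˡ u v) (*-congʳ (/-cancelˡ p q)) ⟩
      ⟦ u ⟧ *ʳ (⟦ p ⟧ *ʳ y) ∎

  -- The function `h` and the symmetric weight `w`.

  h : ℕ → Carrier
  h zero    = 1#
  h (suc n) = suc n /ʳ suc (2 * suc n) *ʳ h n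

  h-suc : ∀ n → odd (suc n) *ʳ h (suc n) ≈ ⟦ suc n ⟧ *ʳ h n
  h-suc n = Equivalence.to (cross {suc n} {suc (2 * suc n)} refl refl) ≈-refl

  -- Lets the constant k be solved for from the label at the apex. The inverse is built along the
  -- recursion of `h`, each step contributing (2n + 3) / (n + 1).
  h-inverse : ∀ n → ∃[ y ] y *ʳ h n ≈ 1#
  h-inverse zero = 1# , *-identityˡ 1#
  h-inverse (suc n) with y , yh≈1 ← h-inverse n =
    y *ʳ (recip n *ʳ odd (suc n)) , (begin
      y *ʳ (recip n *ʳ odd (suc n)) *ʳ h (suc n)
        ≈⟨ solve 4 (λ y r o k → (y ⊕ (r ⊕ o)) ⊕ k ⊜ (y ⊕ r) ⊕ (o ⊕ k)) ≈-refl _ _ _ _ ⟩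
      (y *ʳ recip n) *ʳ (odd (suc n) *ʳ h (suc n))
        ≈⟨ *-congˡ (h-suc n) ⟩
      (y *ʳ recip n) *ʳ (⟦ suc n ⟧ *ʳ h n)
        ≈⟨ solve 4 (λ y r s k → (y ⊕ r) ⊕ (s ⊕ k) ⊜ (r ⊕ s) ⊕ (y ⊕ k)) ≈-refl _ _ _ _ ⟩
      (recip n *ʳ ⟦ suc n ⟧) *ʳ (y *ʳ h n)
        ≈⟨ *-cong (recip-inverseˡ n) yh≈1 ⟩
      1# *ʳ 1#
        ≈⟨ *-identityˡ 1# ⟩
      1# ∎)

  module Weight (k : Carrier) where

    w : (α β γ : ℕ) → Carrier
    w α β γ = k *ʳ (h α *ʳ (h β *ʳ h γ))

    w-swapˡ : ∀ α β γ → w α β γ ≈ w β α γ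
    w-swapˡ α β γ =
      solve 4 (λ k x y z → k ⊕ (x ⊕ (y ⊕ z)) ⊜ k ⊕ (y ⊕ (x ⊕ z))) ≈-refl k (h α) (h β) (h γ)

    w-swapʳ : ∀ α β γ → w α β γ ≈ w α γ β
    w-swapʳ α β γ =
      solve 4 (λ k x y z → k ⊕ (x ⊕ (y ⊕ z)) ⊜ k ⊕ (x ⊕ (z ⊕ y))) ≈-refl k (h α) (h β) (h γ)

    -- The horizontal relationship for L = (2α + 1) w, cross-multiplied. It follows by reading
    -- `h-suc` forwards at α and backwards at β.
    w-horizontal : ∀ α β γ →
      ⟦ suc β ⟧ *ʳ (odd α *ʳ (odd (suc α) *ʳ w (suc α) β γ)) ≈
      odd (suc β) *ʳ (⟦ suc α ⟧ *ʳ (odd α *ʳ w α (suc β) γ))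
    w-horizontal α β γ = begin
      ⟦ suc β ⟧ *ʳ (odd α *ʳ (odd (suc α) *ʳ (k *ʳ (h (suc α) *ʳ (h β *ʳ h γ)))))
        ≈⟨ solve 7 (λ s o p k x y z → s ⊕ (o ⊕ (p ⊕ (k ⊕ (x ⊕ (y ⊕ z)))))
                                      ⊜ (o ⊕ (k ⊕ z)) ⊕ ((p ⊕ x) ⊕ (s ⊕ y))) ≈-refl _ _ _ _ _ _ _ ⟩
      (odd α *ʳ (k *ʳ h γ)) *ʳ ((odd (suc α) *ʳ h (suc α)) *ʳ (⟦ suc β ⟧ *ʳ h β))
        ≈⟨ *-congˡ (*-cong (h-suc α) (≈-sym (h-suc β))) ⟩
      (odd α *ʳ (k *ʳ h γ)) *ʳ ((⟦ suc α ⟧ *ʳ h α) *ʳ (odd (suc β) *ʳ h (suc β)))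
        ≈⟨ solve 7 (λ s o p k x y z → (o ⊕ (k ⊕ z)) ⊕ ((p ⊕ x) ⊕ (s ⊕ y))
                                      ⊜ s ⊕ (p ⊕ (o ⊕ (k ⊕ (x ⊕ (y ⊕ z)))))) ≈-refl _ _ _ _ _ _ _ ⟩
      odd (suc β) *ʳ (⟦ suc α ⟧ *ʳ (odd α *ʳ (k *ʳ (h α *ʳ (h (suc β) *ʳ h γ))))) ∎

    -- The same exchange of `h-suc` between β and γ. The factor `odd 0`, equal to 1, is kept so that
    -- both sides have the shape of left labels.
    w-vertical : ∀ β γ →
      ⟦ suc γ ⟧ *ʳ (odd (suc β) *ʳ (odd 0 *ʳ w 0 (suc β) γ)) ≈
      odd (suc γ) *ʳ (⟦ suc β ⟧ *ʳ (odd 0 *ʳ w 0 β (suc γ)))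
    w-vertical β γ = begin
      ⟦ suc γ ⟧ *ʳ (odd (suc β) *ʳ (odd 0 *ʳ (k *ʳ (h 0 *ʳ (h (suc β) *ʳ h γ)))))
        ≈⟨ solve 7 (λ s p o k x y z → s ⊕ (p ⊕ (o ⊕ (k ⊕ (x ⊕ (y ⊕ z)))))
                                      ⊜ (o ⊕ (k ⊕ x)) ⊕ ((p ⊕ y) ⊕ (s ⊕ z))) ≈-refl _ _ _ _ _ _ _ ⟩
      (odd 0 *ʳ (k *ʳ h 0)) *ʳ ((odd (suc β) *ʳ h (suc β)) *ʳ (⟦ suc γ ⟧ *ʳ h γ))
        ≈⟨ *-congˡ (*-cong (h-suc β) (≈-sym (h-suc γ))) ⟩
      (odd 0 *ʳ (k *ʳ h 0)) *ʳ ((⟦ suc β ⟧ *ʳ h β) *ʳ (odd (suc γ) *ʳ h (suc γ)))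
        ≈⟨ solve 7 (λ s p o k x y z → (o ⊕ (k ⊕ x)) ⊕ ((p ⊕ y) ⊕ (s ⊕ z))
                                      ⊜ s ⊕ (p ⊕ (o ⊕ (k ⊕ (x ⊕ (y ⊕ z)))))) ≈-refl _ _ _ _ _ _ _ ⟩
      odd (suc γ) *ʳ (⟦ suc β ⟧ *ʳ (odd 0 *ʳ (k *ʳ (h 0 *ʳ (h β *ʳ h (suc γ)))))) ∎

-- The edge-ratio relationships in the coordinates α, β, γ, cleared of denominators.

module Grid {ℝ : RealNumbers a ℓ₁ ℓ₂ ℓ₃} {c : ℕ} (T : LabelledGrid ℝ c) where
  open RealNumbers ℝ hiding (+-comm; +-assoc)
  open LabelledGrid T
  open EdgeRatios ℝ
  open Arithmetic ℝ
  private
    *-monoid = CommutativeRing.*-commutativeMonoid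
      (HeytingCommutativeRing.commutativeRing heytingCommutativeRing)
  open CommutativeMonoidSolver *-monoid using (solve; _⊕_; _⊜_)
  open SetoidReasoning setoid

  odd-suc : ∀ n → 2 * n + 3 ≡ suc (2 * suc n)
  odd-suc n = +-*-Solver.solve 1
    (λ m → con 2 :* m :+ con 3 := con 1 :+ con 2 :* (con 1 :+ m)) refl n
    where open +-*-Solver using (con; _:*_; _:+_; _:=_)

  right-left⇔ : ∀ α β {x y} → x ≈ rRL (suc (α + β)) (suc α) (s≤s z≤n) *ʳ y ⇔
                odd α *ʳ x ≈ odd β *ʳ y
  right-left⇔ α β = cross {{2d∸1-nonZero {suc α} (s≤s z≤n)}}
    (trans (+-comm _ 1) (cong (λ m → suc (2 * m)) (m+n∸m≡n α β))) (+-suc α (α + 0))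

  base-left⇔ : ∀ α β γ → suc (α + β + γ) ≡ c → ∀ {x y} →
               x ≈ rBL c (suc (α + β)) (suc α) (s≤s z≤n) *ʳ y ⇔
               odd α *ʳ x ≈ odd γ *ʳ y
  base-left⇔ α β γ refl = cross {{2d∸1-nonZero {suc α} (s≤s z≤n)}}
    (trans (+-comm _ 1) (cong (λ m → suc (2 * m)) (m+n∸m≡n (α + β) γ))) (+-suc α (α + 0))

  -- On the side α = 0, r = β + 2 turns `ratioX` into (β + 1) / (2β + 3) times (2γ + 3) / (γ + 1).
  vertical⇔ : ∀ β γ → suc (suc β + γ) ≡ c → .(2≤r : 2 ≤ suc (suc β)) → ∀ {x y} →
              x ≈ ratioX c (suc (suc β)) 2≤r *ʳ y ⇔
              ⟦ suc γ ⟧ *ʳ (odd (suc β) *ʳ x) ≈ odd (suc γ) *ʳ (⟦ suc β ⟧ *ʳ y)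
  vertical⇔ β γ refl 2≤r =
    cross₂ {p = suc β} {{2d∸1-nonZero {suc (suc β)} (≤-trans (s≤s z≤n) 2≤r)}}
      refl (+-suc (suc β) (suc β + 0))
      (trans (odd-suc (suc β + γ ∸ suc β)) (cong (λ m → suc (2 * suc m)) γ≡)) (cong suc γ≡)
    where
    γ≡ : suc β + γ ∸ suc β ≡ γ
    γ≡ = m+n∸m≡n (suc β) γ

  -- Here d = α + 2, so `ratioY` is (α + 1) / (2α + 1) times (2β + 3) / (β + 1).
  horizontal⇔ : ∀ α β .(2≤d : 2 ≤ suc (suc α)) {x y} →
                x ≈ ratioY (suc (suc α + β)) (suc (suc α)) 2≤d *ʳ y ⇔
                ⟦ suc β ⟧ *ʳ (odd α *ʳ x) ≈ odd (suc β) *ʳ (⟦ suc α ⟧ *ʳ y)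
  horizontal⇔ α β 2≤d =
    cross₂ {p = suc α} {{2d∸3-nonZero {suc (suc α)} 2≤d}}
      refl (trans (cong (_∸ 1) (+-suc α (suc α + 0))) (+-suc α (α + 0)))
      (trans (odd-suc (α + β ∸ α)) (cong (λ m → suc (2 * suc m)) β≡)) (cong suc β≡)
    where
    β≡ : α + β ∸ α ≡ β
    β≡ = m+n∸m≡n α β

  -- The product form, its invariance under the exchanges, and the relationships it implies.

  module Solution (k : Carrier) where
    open Weight k

    -- All three sides are recorded together because the symmetries permute them: the left label of
    -- one triangle is the right label of its mirror image.
    record Harmonic (α β γ : ℕ) .(e : suc (α + β + γ) ≡ c) : Set ℓ₁ where
      field
        left  : label L (at α β γ e) ≈ odd α *ʳ w α β γ
        right : label R (at α β γ e) ≈ odd β *ʳ w α β γ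
        base  : label B (at α β γ e) ≈ odd γ *ʳ w α β γ

    open Harmonic

    module _ {α β γ : ℕ} (e : suc (α + β + γ) ≡ c) where

      -- The right-left and base-left relationships express the other two labels through the left
      -- one, and the common factor 2α + 1 cancels.
      fromLeft : EdgeRatioRelationships T (at α β γ e) →
                 label L (at α β γ e) ≈ odd α *ʳ w α β γ → Harmonic α β γ e
      fromLeft E l = record
        { left  = l
        ; right = scale (Equivalence.to (right-left⇔ α β) (EdgeRatioRelationships.right-left E))
        ; base  = scale (Equivalence.to (base-left⇔ α β γ e) (EdgeRatioRelationships.base-left E))
        }
        where
        scale : ∀ {x o} → odd α *ʳ x ≈ o *ʳ label L (at α β γ e) → x ≈ o *ʳ w α β γ
        scale {x} {o} eq = ⟦⟧-cancelˡ (suc (2 * α)) (begin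
          odd α *ʳ x                          ≈⟨ eq ⟩
          o *ʳ label L (at α β γ e)       ≈⟨ *-congˡ l ⟩
          o *ʳ (odd α *ʳ w α β γ)
            ≈⟨ solve 3 (λ n a w → n ⊕ (a ⊕ w) ⊜ a ⊕ (n ⊕ w)) ≈-refl _ _ _ ⟩
          odd α *ʳ (o *ʳ w α β γ)         ∎)

    module _ (S : Symmetric T) {α β γ : ℕ} (e : suc (α + β + γ) ≡ c) where
      private
        module V = VerticalSymmetry (Symmetric.vertical S)
        module Sl = SlideSymmetry (Symmetric.slides S)

        ≡⇒≈ : ∀ {s t t′} → t ≡ t′ → label s t ≈ label s t′
        ≡⇒≈ refl = ≈-refl

      harmonic-swapˡ : Harmonic β α γ (swapˡ {α = α} e) → Harmonic α β γ e
      harmonic-swapˡ H = record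
        { left  = ≈-trans (V.left-right _) (≈-trans (≡⇒≈ (flip-at e)) (swap (right H)))
        -- The symmetry sends L to R only, so it is read backwards from the mirror image, whose flip
        -- is the original triangle.
        ; right = ≈-trans (≈-sym (≈-trans (V.left-right _) (≡⇒≈ (flip-at (swapˡ {α = α} e)))))
                          (swap (left H))
        ; base  = ≈-trans (V.base-base _) (≈-trans (≡⇒≈ (flip-at e)) (swap (base H)))
        }
        where
        swap : ∀ {x y} → x ≈ y *ʳ w β α γ → x ≈ y *ʳ w α β γ
        swap eq = ≈-trans eq (*-congˡ (w-swapˡ β α γ))

      harmonic-swapʳ : Harmonic α γ β (swapʳ {α = α} e) → Harmonic α β γ e
      harmonic-swapʳ H = record
        { left  = ≈-trans (Sl.left-left _) (≈-trans (≡⇒≈ (slide-at e)) (swap (left H)))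
        ; right = ≈-trans (Sl.right-base _) (≈-trans (≡⇒≈ (slide-at e)) (swap (base H)))
        -- Again backwards: the slide of the slid triangle is the original one.
        ; base  = ≈-trans (≈-sym (≈-trans (Sl.right-base _) (≡⇒≈ (slide-at (swapʳ {α = α} e)))))
                          (swap (right H))
        }
        where
        swap : ∀ {x y} → x ≈ y *ʳ w α γ β → x ≈ y *ʳ w α β γ
        swap eq = ≈-trans eq (*-congˡ (w-swapʳ α γ β))

    -- Each relationship compares two values of the product form. The vertical and horizontal ones
    -- also involve a neighbouring triangle, so the form is assumed on the whole grid.
    relationships : (∀ α β γ e → Harmonic α β γ e) →
                    ∀ α β γ e → EdgeRatioRelationships T (at α β γ e)
    relationships H α β γ e = record
      { vertical   = vert α β e
      ; horizontal = horiz α β e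
      ; right-left = Equivalence.from (right-left⇔ α β) (proportional (left (H α β γ e)) (right (H α β γ e)))
      ; base-left  = Equivalence.from (base-left⇔ α β γ e) (proportional (left (H α β γ e)) (base (H α β γ e)))
      }
      where
      proportional : ∀ {x y m n z} → y ≈ m *ʳ z → x ≈ n *ʳ z → m *ʳ x ≈ n *ʳ y
      proportional {x} {y} {m} {n} {z} y≈ x≈ = begin
        m *ʳ x              ≈⟨ *-congˡ x≈ ⟩
        m *ʳ (n *ʳ z)   ≈⟨ solve 3 (λ m n z → m ⊕ (n ⊕ z) ⊜ n ⊕ (m ⊕ z)) ≈-refl _ _ _ ⟩
        n *ʳ (m *ʳ z)   ≈⟨ *-congˡ y≈ ⟨
        n *ʳ y              ∎

      vert : ∀ α β (e : suc (α + β + γ) ≡ c) (d≡1 : suc α ≡ 1) (2≤r : 2 ≤ suc (α + β)) →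
             label L (at α β γ e) ≈
             ratioX c (suc (α + β)) 2≤r *ʳ label L (above (at α β γ e) d≡1 2≤r)
      vert zero (suc β) e _ 2≤r = Equivalence.from (vertical⇔ β γ e 2≤r) (begin
        _  ≈⟨ *-congˡ (*-congˡ (left (H 0 (suc β) γ e))) ⟩
        _  ≈⟨ w-vertical β γ ⟩
        _  ≈⟨ *-congˡ (*-congˡ (left (H 0 β (suc γ) (trans (cong suc (+-suc β γ)) e)))) ⟨
        _  ∎)
      vert zero zero e _ (s≤s ())

      horiz : ∀ α β (e : suc (α + β + γ) ≡ c) (2≤d : 2 ≤ suc α) →
              label L (at α β γ e) ≈
              ratioY (suc (α + β)) (suc α) 2≤d *ʳ label L (leftOf (at α β γ e) 2≤d)
      horiz zero    β e (s≤s ())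
      -- The row is the sum (α + 1) + β here but α + (β + 1) for the neighbour, so unlike in `vert`
      -- the two triangles must be identified by a proof.
      horiz (suc α) β e 2≤d rewrite leftOf-at {α = α} {β} e 2≤d =
        Equivalence.from (horizontal⇔ α β 2≤d) (begin
          _  ≈⟨ *-congˡ (*-congˡ (left (H (suc α) β γ e))) ⟩
          _  ≈⟨ w-horizontal α β γ ⟩
          _  ≈⟨ *-congˡ (*-congˡ (left (H α (suc β) γ (trans (cong (λ m → suc (m + γ)) (+-suc α β)) e)))) ⟨
          _  ∎)

    -- Spreading the product form from the apex over the fundamental domain and then the grid.

    module _ (S : Symmetric T)
             (E : ∀ t → UpperLeftHalf t → EdgeRatioRelationships T t)
             (apex : ∀ γ (e : suc γ ≡ c) → label L (at 0 0 γ e) ≈ odd 0 *ʳ w 0 0 γ) where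

      -- Descent along the left side by the vertical relationship: the predecessor (0, β, γ + 1) of
      -- (0, β + 1, γ) is still in the fundamental domain.
      harmonic-edge : ∀ β γ e → β ≤ γ → Harmonic 0 β γ e
      harmonic-edge zero γ e 0≤γ = fromLeft e (E _ (upperLeftHalf e z≤n 0≤γ)) (apex γ e)
      harmonic-edge (suc β) γ e β<γ =
        fromLeft e Et (⟦⟧-cancelˡ (suc (2 * suc β)) (⟦⟧-cancelˡ (suc γ) (begin
          _  ≈⟨ Equivalence.to (vertical⇔ β γ e 2≤r)
                  (EdgeRatioRelationships.vertical Et refl 2≤r) ⟩
          _  ≈⟨ *-congˡ (*-congˡ (left H)) ⟩
          _  ≈⟨ w-vertical β γ ⟨
          _  ∎)))
        where
        Et = E _ (upperLeftHalf e z≤n β<γ)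
        2≤r : 2 ≤ suc (suc β)
        2≤r = s≤s (s≤s z≤n)
        e′ : suc (β + suc γ) ≡ c
        e′ = trans (cong suc (+-suc β γ)) e
        H : Harmonic 0 β (suc γ) e′
        H = harmonic-edge β (suc γ) e′ (≤-trans (n≤1+n β) (≤-trans β<γ (n≤1+n γ)))

      -- Induction on α by the horizontal relationship, the left neighbour of (α + 1, β, γ) being
      -- (α, β + 1, γ). β and γ stay general because a slide may exchange them.
      harmonic-sorted : ∀ α β γ e → α ≤ β → β ≤ γ → Harmonic α β γ e
      harmonic-sorted zero β γ e _ β≤γ = harmonic-edge β γ e β≤γ
      harmonic-sorted (suc α) β γ e α<β β≤γ =
        fromLeft e Et (⟦⟧-cancelˡ (suc (2 * α)) (⟦⟧-cancelˡ (suc β) (begin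
          _  ≈⟨ Equivalence.to (horizontal⇔ α β 2≤d) Eh ⟩
          _  ≈⟨ *-congˡ (*-congˡ (left H)) ⟩
          _  ≈⟨ w-horizontal α β γ ⟨
          _  ∎)))
        where
        Et = E _ (upperLeftHalf e α<β β≤γ)
        e′ : suc (α + suc β + γ) ≡ c
        e′ = trans (cong (λ m → suc (m + γ)) (+-suc α β)) e
        2≤d : 2 ≤ suc (suc α)
        2≤d = s≤s (s≤s z≤n)
        Eh : label L (at (suc α) β γ e) ≈
             ratioY (suc (suc α + β)) (suc (suc α)) 2≤d *ʳ label L (at α (suc β) γ e′)
        Eh = subst (λ t → label L (at (suc α) β γ e) ≈
                          ratioY (suc (suc α + β)) (suc (suc α)) 2≤d *ʳ label L t)
                   (leftOf-at {α = α} {β} e 2≤d) (EdgeRatioRelationships.horizontal Et 2≤d)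
        α≤β = ≤-trans (n≤1+n α) α<β
        -- Moving left can leave the fundamental domain only when β = γ, and then
        -- a slide leads back into it.
        H : Harmonic α (suc β) γ e′
        H with ≤-total (suc β) γ
        ... | inj₁ β<γ = harmonic-sorted α (suc β) γ e′ (≤-trans α≤β (n≤1+n β)) β<γ
        ... | inj₂ γ≤β = harmonic-swapʳ S e′
                (harmonic-sorted α γ (suc β) (swapʳ {α = α} e′) (≤-trans α≤β β≤γ) γ≤β)

      -- Sorting by adjacent exchanges: γ is inserted into the ordered pair α ≤ β.
      harmonic-α≤β : ∀ α β γ e → α ≤ β → Harmonic α β γ e
      harmonic-α≤β α β γ e α≤β with ≤-total β γ | ≤-total α γ
      ... | inj₁ β≤γ | _        = harmonic-sorted α β γ e α≤β β≤γ
      ... | inj₂ γ≤β | inj₁ α≤γ =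
        harmonic-swapʳ S e (harmonic-sorted α γ β (swapʳ {α = α} e) α≤γ γ≤β)
      ... | inj₂ γ≤β | inj₂ γ≤α =
        -- Here γ ≤ α ≤ β, reached through (α, β, γ), (α, γ, β), (γ, α, β).
        harmonic-swapʳ S e (harmonic-swapˡ S e′
          (harmonic-sorted γ α β (swapˡ {α = α} e′) γ≤α α≤β))
        where e′ = swapʳ {α = α} e

      harmonic : ∀ α β γ e → Harmonic α β γ e
      harmonic α β γ e with ≤-total α β
      ... | inj₁ α≤β = harmonic-α≤β α β γ e α≤β
      ... | inj₂ β≤α = harmonic-swapˡ S e (harmonic-α≤β β α γ (swapˡ {α = α} e) β≤α)

-- Choice of the constant and conclusion.

theorem6 : ∀ {a ℓ₁ ℓ₂ ℓ₃ : Level} (ℝ : RealNumbers a ℓ₁ ℓ₂ ℓ₃) (c : ℕ) → 1 ≤ c →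
    (T : LabelledGrid ℝ c) → Symmetric T →
    (∀ (t : Triangle c) → UpperLeftHalf t → EdgeRatioRelationships T t) →
    (∀ (t : Triangle c) → EdgeRatioRelationships T t)
theorem6 ℝ (suc n) _ T S E =
  at-elim (EdgeRatioRelationships T) (relationships (harmonic S E apex))
  where
  open RealNumbers ℝ hiding (+-comm; +-assoc)
  open LabelledGrid T
  open Arithmetic ℝ
  open Grid T
  h⁻¹ = proj₁ (h-inverse n)
  top = label L (at 0 0 n refl)
  -- At the apex α = β = 0, γ = n = c - 1 and h(0) = 1, so the product form there reads `top` = k
  -- h(n), which fixes k.
  open Solution (top *ʳ h⁻¹)
  open Weight (top *ʳ h⁻¹)
  apex : ∀ γ (e : suc γ ≡ suc n) → label L (at 0 0 γ e) ≈ odd 0 *ʳ w 0 0 γ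
  apex _ refl = ≈-sym (begin
    odd 0 *ʳ (top *ʳ h⁻¹ *ʳ (1# *ʳ (1# *ʳ h n)))
      ≈⟨ *-cong (+-identityʳ 1#) (*-congˡ (≈-trans (*-identityˡ _) (*-identityˡ _))) ⟩
    1# *ʳ (top *ʳ h⁻¹ *ʳ h n)    ≈⟨ *-identityˡ _ ⟩
    top *ʳ h⁻¹ *ʳ h n            ≈⟨ *-assoc _ _ _ ⟩
    top *ʳ (h⁻¹ *ʳ h n)          ≈⟨ *-congˡ (proj₂ (h-inverse n)) ⟩
    top *ʳ 1#                    ≈⟨ *-identityʳ _ ⟩
    top                          ∎)
    where open SetoidReasoning setoid
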